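{- For every integer $n\ge 1$, the pairs of statistics $(\mathrm{rlm},\mathrm{w\overline{m}}-1)$ and $(\mathrm{w\overline{m}}-1,\mathrm{rlm})$ are equally distributed on $S_n$.
   Context: $S_n$ is the set of permutations $\pi=\pi_1\pi_2\cdots\pi_n$ of $[n]=\{1,\dots,n\}$. For a word $w=w_1\cdots w_m$ of distinct integers, $w_i$ is an RL-maximum if $w_i>w_j$ for all $j>i$. For $\pi\in S_n$, $\mathrm{rlm}(\pi)$ is the number of RL-maxima of the (possibly empty) subword of $\pi$ consisting of the letters to the left of the letter $1$. An index $i$ is a weak excedance of $\pi$ if $\pi_i\ge i$; it is a mid-point of $\pi$ if there exist $j<i<k$ with $\pi_j>\pi_i>\pi_k$, and a non-mid-point otherwise. $\mathrm{w\overline{m}}(\pi)$ is the number of indices $i$ that are both a weak excedance and a non-mid-point of $\pi$. Two pairs of statistics $(f_1,f_2)$ and $(g_1,g_2)$ are equally distributed on a finite set $X$ if for all $(a_1,a_2)$ the number of $x\in X$ with $(f_1(x),f_2(x))=(a_1,a_2)$ equals the number of $x\in X$ with $(g_1(x),g_2(x))=(a_1,a_2)$. -}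

module Defs where

open import Data.Fin.Base using (Fin; toℕ; _<_; _>_; _≥_)
open import Data.Fin.Properties using (_≟_; _<?_; _≤?_; all?; any?)
import Data.Integer.Base as ℤ
open import Data.Integer.Base using (ℤ; +_)
import Data.Integer.Properties as ℤ
open import Data.List.Base
  using (List; []; _∷_; length; lookup; filter; takeWhile; allFin; cartesianProductWith)
open import Data.List.Membership.Propositional using (_∈_)
open import Data.List.Membership.Propositional.Properties
  using (∈-filter⁺; ∈-filter⁻; ∈-allFin; ∈-cartesianProductWith⁺)
open import Data.List.Relation.Unary.All using ([])
open import Data.List.Relation.Unary.AllPairs using ([]; _∷_)
open import Data.List.Relation.Unary.Any using (here)
open import Data.List.Relation.Unary.Unique.Propositional using (Unique)
open import Data.List.Relation.Unary.Unique.Propositional.Properties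
  using (allFin⁺; filter⁺; cartesianProductWith⁺)
open import Data.Nat.Base using (ℕ; zero; suc)
import Data.Nat.Properties as ℕ
open import Data.Product.Base using (_×_; _,_; ∃₂; proj₂)
open import Data.Vec.Base using (Vec; []; _∷_; toList)
import Data.Vec.Base as Vec
open import Data.Vec.Properties using (∷-injective)
open import Function.Base using (case_of_)
open import Function.Bundles using (_⇔_; mk⇔)
open import Function.Definitions using (Bijective; Injective; Surjective)
open import Level using (0ℓ)
open import Relation.Binary.PropositionalEquality using (_≡_; refl)
open import Relation.Nullary.Decidable using (Dec; map′; ¬?; _×-dec_; _→-dec_)
open import Relation.Unary using (Pred; Decidable)

private
  variable
    n : ℕ

-- The set [n] = {1,…,n} is Fin n, with i : Fin n standing for the integer
-- toℕ i + 1.  Letters and positions are shifted alike, so all comparisons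
-- between them are unaffected.
Word : ℕ → Set
Word n = Vec (Fin n) n

IsPermutation : Word n → Set
IsPermutation π = Bijective _≡_ _≡_ (Vec.lookup π)

injective? : (π : Word n) → Dec (Injective _≡_ _≡_ (Vec.lookup π))
injective? π =
  map′ (λ f {i} {j} → f i j) (λ f i j → f {i} {j})
    (all? λ i → all? λ j → (Vec.lookup π i ≟ Vec.lookup π j) →-dec (i ≟ j))

surjective? : (π : Word n) → Dec (Surjective _≡_ _≡_ (Vec.lookup π))
surjective? π =
  map′ (λ f v → case f v of λ { (i , e) → i , λ { refl → e } })
       (λ f v → case f v of λ { (i , e) → i , e refl })
    (all? λ v → any? λ i → Vec.lookup π i ≟ v)

isPermutation? : Decidable (IsPermutation {n})
isPermutation? π = injective? π ×-dec surjective? π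

words : (n k : ℕ) → List (Vec (Fin n) k)
words n zero    = [] ∷ []
words n (suc k) = cartesianProductWith _∷_ (allFin n) (words n k)

-- The finite set Sₙ, as a list; ∈-𝕊 and 𝕊-unique below show that each
-- permutation is listed exactly once.
𝕊 : (n : ℕ) → List (Word n)
𝕊 n = filter isPermutation? (words n n)

∈-words : ∀ {k} (w : Vec (Fin n) k) → w ∈ words n k
∈-words []      = here refl
∈-words (x ∷ w) = ∈-cartesianProductWith⁺ _∷_ (∈-allFin x) (∈-words w)

words-unique : ∀ n k → Unique (words n k)
words-unique n zero    = [] ∷ []
words-unique n (suc k) =
  cartesianProductWith⁺ _∷_ ∷-injective (allFin⁺ n) (words-unique n k)

∈-𝕊 : (π : Word n) → π ∈ 𝕊 n ⇔ IsPermutation π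
∈-𝕊 {n} π = mk⇔ (λ p → proj₂ (∈-filter⁻ isPermutation? {xs = words n n} p))
                (∈-filter⁺ isPermutation? (∈-words π))

𝕊-unique : ∀ n → Unique (𝕊 n)
𝕊-unique n = filter⁺ isPermutation? (words-unique n n)

#_ : {P : Pred (Fin n) 0ℓ} → Decidable P → ℕ
#_ {n} P? = length (filter P? (allFin n))

IsRLMax : (w : List (Fin n)) → Pred (Fin (length w)) 0ℓ
IsRLMax w i = ∀ j → j > i → lookup w i > lookup w j

isRLMax? : (w : List (Fin n)) → Decidable (IsRLMax w)
isRLMax? w i = all? λ j → (i <? j) →-dec (lookup w j <? lookup w i)

-- The letter 1 is the element of Fin n with toℕ equal to 0.
leftOf1 : Word n → List (Fin n)
leftOf1 π = takeWhile (λ v → ¬? (toℕ v ℕ.≟ 0)) (toList π)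

rlm : Word n → ℕ
rlm π = # isRLMax? (leftOf1 π)

IsWeakExcedance : Word n → Pred (Fin n) 0ℓ
IsWeakExcedance π i = Vec.lookup π i ≥ i

isWeakExcedance? : (π : Word n) → Decidable (IsWeakExcedance π)
isWeakExcedance? π i = i ≤? Vec.lookup π i

IsMidPoint : Word n → Pred (Fin n) 0ℓ
IsMidPoint π i = ∃₂ λ j k →
  (j < i × i < k) × (Vec.lookup π j > Vec.lookup π i × Vec.lookup π i > Vec.lookup π k)

isMidPoint? : (π : Word n) → Decidable (IsMidPoint π)
isMidPoint? π i = any? λ j → any? λ k →
  ((j <? i) ×-dec (i <? k)) ×-dec
  ((Vec.lookup π i <? Vec.lookup π j) ×-dec (Vec.lookup π k <? Vec.lookup π i))

wnm : Word n → ℕ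
wnm π = # λ i → isWeakExcedance? π i ×-dec ¬? (isMidPoint? π i)

-- Integer-valued, so that the subtraction is not truncated.
rlmℤ wnm-1 : Word n → ℤ
rlmℤ π = + rlm π
wnm-1 π = + wnm π ℤ.- + 1

-- The finite set X is given by a duplicate-free list of its elements.
EquallyDistributed : {A : Set} (X : List A) (f g : (A → ℤ) × (A → ℤ)) → Set
EquallyDistributed X (f₁ , f₂) (g₁ , g₂) = ∀ a₁ a₂ →
  length (filter (λ x → (f₁ x ℤ.≟ a₁) ×-dec (f₂ x ℤ.≟ a₂)) X) ≡
  length (filter (λ x → (g₁ x ℤ.≟ a₁) ×-dec (g₂ x ℤ.≟ a₂)) X)

{-# OPTIONS --safe #-}

-- On permutations the weak excedances that are not mid-points are exactly the
-- left-to-right maxima.  A permutation of n + 1 letters (n ≥ 1) arises uniquely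
-- from one of n letters by raising every letter other than 1 and inserting a
-- new letter 2.  Inserting it just before the 1 increases rlm by one; inserting
-- it first (or just after the 1, if the 1 comes first) creates one left-to-right
-- maximum; every other position leaves both statistics unchanged.  So
-- ∑ x^rlm y^(wnm − 1) over Sₙ₊₁ is x + y + n − 1 times that over Sₙ, which is
-- symmetric in x and y by induction.

module Submission where

open import Defs
open import Data.Bool.Base using (true; false; if_then_else_)
open import Data.Fin.Base using (Fin; zero; suc; toℕ; punchIn; punchOut; _<_; _≤_)
open import Data.Fin.Patterns using (1F)
open import Data.Fin.Permutation using (transpose; _⟨$⟩ʳ_; _⟨$⟩ˡ_; inverseˡ)
open import Data.Fin.Properties
  using (_≟_; _<?_; punchInᵢ≢i; punchIn-injective; punchIn-punchOut;
         injective⇒existsPivot; all?; toℕ-injective)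
import Data.Integer.Base as ℤ
open import Data.Integer.Base using (ℤ)
import Data.Integer.Properties as ℤ
open import Data.List.Base
  using (List; []; _∷_; _++_; length; filter; takeWhile; allFin; tabulate; replicate;
         map; concatMap; cartesianProductWith)
open import Data.List.Membership.Propositional using (_∈_)
open import Data.List.Membership.Propositional.Properties
  using (∈-allFin; ∈-cartesianProductWith⁺; ∈-cartesianProductWith⁻; ∈-lookup)
open import Data.List.Membership.Propositional.Properties.WithK using (unique∧set⇒bag)
open import Data.List.Properties
  using (filter-≐; map-++; map-∘; map-tabulate; tabulate-cong;
         map-replicate; map-concatMap; concatMap-map)
open import Data.List.Relation.Binary.BagAndSetEquality using (∼bag⇒↭)
open import Data.List.Relation.Binary.Permutation.Propositional
  using (_↭_; ↭-refl; ↭-prep; ↭-swap; ↭-trans; ↭-reflexive; module PermutationReasoning)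
open import Data.List.Relation.Binary.Permutation.Propositional.Properties
  using (↭-length; map⁺; ++⁺; ++⁺ˡ; shifts; filter-↭)
open import Data.List.Relation.Unary.All using (All; []; _∷_)
import Data.List.Relation.Unary.All as All
import Data.List.Relation.Unary.All.Properties as All
import Data.List.Relation.Unary.Any as Any
open import Data.List.Relation.Unary.Any.Properties using (lookup-index)
open import Data.List.Relation.Unary.Unique.Propositional.Properties
  using (allFin⁺; cartesianProductWith⁺)
open import Data.Nat.Base using (ℕ; zero; suc; _+_; _≥_; z≤n; s≤s; s≤s⁻¹)
import Data.Nat.Properties as ℕ
import Data.Product.Base as Product
open import Data.Product.Base using (∃; ∃₂; _×_; _,_; proj₁; proj₂; swap)
open import Data.Vec.Base using (Vec; []; _∷_; lookup; insertAt; toList)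
import Data.Vec.Base as Vec
open import Data.Vec.Properties
  using (insertAt-lookup; insertAt-punchIn; lookup-map;
         tabulate∘lookup; lookup∘tabulate)
import Data.Vec.Properties as Vec
open import Function.Base using (_∘_; id; _∘′_)
open import Function.Bundles using (_⇔_; mk⇔; Equivalence)
open import Function.Construct.Composition using (_⇔-∘_)
open import Function.Related.Propositional using (≡⇒)
open import Function.Definitions using (Injective; Surjective)
open import Level using (0ℓ)
open import Relation.Binary.PropositionalEquality
  using (_≡_; _≢_; _≗_; refl; sym; trans; cong; cong₂; subst; module ≡-Reasoning)
open import Relation.Nullary.Decidable
  using (Dec; yes; no; does; ¬?; _×-dec_; _→-dec_; does-⇔; dec-true; dec-false)
open import Relation.Nullary.Negation using (¬_; contradiction)
open import Relation.Unary using (Pred; Decidable)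

private
  variable
    k l n : ℕ
    A B : Set

-- Iverson brackets and counting.

⟦_⟧ : Dec A → ℕ
⟦ d ⟧ = if does d then 1 else 0

-- The bracket depends only on the truth value in `does`, not on how the proposition was decided.
⟦⟧-cong : A ⇔ B → (a? : Dec A) (b? : Dec B) → ⟦ a? ⟧ ≡ ⟦ b? ⟧
⟦⟧-cong A⇔B a? b? = cong (if_then 1 else 0) (does-⇔ A⇔B a? b?)

-- Counting is transported along `f`. The equivalence is asked only of members of the list, because
-- the statistics are later identified with their recursive forms on permutations only.
length-filter-map : {P : Pred A 0ℓ} {Q : Pred B 0ℓ} (P? : Decidable P) (Q? : Decidable Q)
                    (f : A → B) {xs : List A} → All (λ x → P x ⇔ Q (f x)) xs →
                    length (filter P? xs) ≡ length (filter Q? (map f xs))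
length-filter-map P? Q? f []       = refl
length-filter-map P? Q? f {x ∷ _} (P⇔Q ∷ eqs)
  rewrite does-⇔ P⇔Q (P? x) (Q? (f x)) with does (Q? (f x))
... | true  = cong suc (length-filter-map P? Q? f eqs)
... | false = length-filter-map P? Q? f eqs

#-cong : {P Q : Pred (Fin n) 0ℓ} (P? : Decidable P) (Q? : Decidable Q) →
         (∀ i → P i ⇔ Q i) → # P? ≡ # Q?
#-cong P? Q? P⇔Q = cong length (filter-≐ P? Q?
  ((λ {i} → Equivalence.to (P⇔Q i)) , (λ {i} → Equivalence.from (P⇔Q i))) (allFin _))

length-filter-tabulate-suc : {P : Pred (Fin (suc n)) 0ℓ} (P? : Decidable P) →
                             length (filter P? (tabulate suc)) ≡ # (P? ∘ suc)
length-filter-tabulate-suc {n} P? = begin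
  length (filter P? (tabulate suc))        ≡⟨ cong (length ∘ filter P?) (map-tabulate id suc) ⟨
  length (filter P? (map suc (allFin n)))
    ≡⟨ length-filter-map (P? ∘ suc) P? suc (All.universal (λ _ → mk⇔ id id) (allFin n)) ⟨
  # (P? ∘ suc)                             ∎
  where open ≡-Reasoning

#-suc : {P : Pred (Fin (suc n)) 0ℓ} (P? : Decidable P) →
        # P? ≡ ⟦ P? zero ⟧ + # (P? ∘ suc)
#-suc P? with does (P? zero)
... | true  = cong suc (length-filter-tabulate-suc P?)
... | false = length-filter-tabulate-suc P?

-- Recursive forms of the counts of RL-maxima and left-to-right maxima.

leftOf : Vec (Fin n) k → List (Fin n)
leftOf w = takeWhile (λ v → ¬? (toℕ v ℕ.≟ 0)) (toList w)

-- The word length is independent of the alphabet, so letters can be peeled off one at a time; the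
-- letter 1 ends the recursion, since only the prefix before it counts.
rl : Vec (Fin n) k → ℕ
rl []          = 0
rl (zero  ∷ w) = 0
rl (suc x ∷ w) = ⟦ All.all? (_<? suc x) (leftOf w) ⟧ + rl w

-- With m the first letter of a word m ∷ w, this is its number of left-to-right
-- maxima minus one.
lr : Fin n → Vec (Fin n) k → ℕ
lr m []      = 0
lr m (x ∷ w) = if does (m <? x) then suc (lr x w) else lr m w

isRLMax-zero : (x : Fin n) (w : List (Fin n)) →
               All (_< x) w ⇔ IsRLMax (x ∷ w) zero
isRLMax-zero x w = mk⇔
  (λ { all zero () ; all (suc j) _ → All.lookup all (∈-lookup j) })
  (λ max → All.tabulate λ y∈w → subst (_< x) (sym (lookup-index y∈w))
                                  (max (suc (Any.index y∈w)) (s≤s z≤n)))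

isRLMax-suc : (x : Fin n) (w : List (Fin n)) (i : Fin (length w)) →
              IsRLMax (x ∷ w) (suc i) ⇔ IsRLMax w i
isRLMax-suc x w i = mk⇔
  (λ max j i<j → max (suc j) (s≤s i<j))
  (λ { max (suc j) (s≤s i<j) → max j i<j })

#RLMax≡rl : (w : Vec (Fin n) k) → # isRLMax? (leftOf w) ≡ rl w
#RLMax≡rl []          = refl
#RLMax≡rl (zero  ∷ w) = refl
#RLMax≡rl (suc x ∷ w) = begin
  # isRLMax? (suc x ∷ leftOf w)
    ≡⟨ #-suc (isRLMax? (suc x ∷ leftOf w)) ⟩
  ⟦ isRLMax? (suc x ∷ leftOf w) zero ⟧ + # (isRLMax? (suc x ∷ leftOf w) ∘ suc)
    ≡⟨ cong₂ _+_
         (sym (⟦⟧-cong (isRLMax-zero (suc x) (leftOf w)) (All.all? (_<? suc x) (leftOf w))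
                       (isRLMax? (suc x ∷ leftOf w) zero)))
         (trans (#-cong (isRLMax? (suc x ∷ leftOf w) ∘ suc) (isRLMax? (leftOf w))
                        (isRLMax-suc (suc x) (leftOf w)))
                (#RLMax≡rl w)) ⟩
  rl (suc x ∷ w) ∎
  where open ≡-Reasoning

IsLRMax : Vec (Fin n) k → Pred (Fin k) 0ℓ
IsLRMax w i = ∀ j → j < i → lookup w j < lookup w i

isLRMax? : (w : Vec (Fin n) k) → Decidable (IsLRMax w)
isLRMax? w i = all? λ j → (j <? i) →-dec (lookup w j <? lookup w i)

isLRMax-zero : (w : Vec (Fin n) (suc k)) → IsLRMax w zero
isLRMax-zero w _ ()

isLRMax-suc : (x : Fin n) (w : Vec (Fin n) k) (i : Fin k) →
              IsLRMax (x ∷ w) (suc i) ⇔ (x < lookup w i × IsLRMax w i)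
isLRMax-suc x w i = mk⇔
  (λ max → max zero (s≤s z≤n) , λ j j<i → max (suc j) (s≤s j<i))
  (λ { (x< , max) zero    _         → x<
     ; (x< , max) (suc j) (s≤s j<i) → max j j<i })

-- The threshold `x` stands for the maximum of the letters already read; carrying it along is what
-- makes the count recursive.
#LRMax>≡lr : (x : Fin n) (w : Vec (Fin n) k) →
             # (λ i → (x <? lookup w i) ×-dec isLRMax? w i) ≡ lr x w
#LRMax>≡lr x []      = refl
#LRMax>≡lr x (y ∷ w) = begin
  # (λ i → (x <? lookup (y ∷ w) i) ×-dec isLRMax? (y ∷ w) i)
    ≡⟨ #-suc (λ i → (x <? lookup (y ∷ w) i) ×-dec isLRMax? (y ∷ w) i) ⟩
  ⟦ (x <? y) ×-dec isLRMax? (y ∷ w) zero ⟧ + # tail?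
    ≡⟨ cong (_+ # tail?)
         (⟦⟧-cong (mk⇔ proj₁ (_, isLRMax-zero (y ∷ w)))
                  ((x <? y) ×-dec isLRMax? (y ∷ w) zero) (x <? y)) ⟩
  ⟦ x <? y ⟧ + # tail?
    ≡⟨ step (x <? y) ⟩
  lr x (y ∷ w) ∎
  where
  open ≡-Reasoning

  tail? : Decidable (λ i → x < lookup w i × IsLRMax (y ∷ w) (suc i))
  tail? i = (x <? lookup w i) ×-dec isLRMax? (y ∷ w) (suc i)

  step : (x<?y : Dec (x < y)) →
         ⟦ x<?y ⟧ + # tail? ≡ (if does x<?y then suc (lr y w) else lr x w)
  -- Later left-to-right maxima exceed `y`, hence also `x`, so `y` becomes the new threshold.
  step (yes x<y) = cong suc (trans
    (#-cong tail? (λ i → (y <? lookup w i) ×-dec isLRMax? w i) λ i → mk⇔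
      (Equivalence.to (isLRMax-suc y w i) ∘ proj₂)
      (λ y<w,max → ℕ.<-trans x<y (proj₁ y<w,max) ,
                   Equivalence.from (isLRMax-suc y w i) y<w,max))
    (#LRMax>≡lr y w))
  -- Now `y ≤ x`, so exceeding `x` already implies exceeding `y`, and the threshold stays.
  step (no x≮y) = trans
    (#-cong tail? (λ i → (x <? lookup w i) ×-dec isLRMax? w i) λ i → mk⇔
      (λ { (x<w , max) → x<w , proj₂ (Equivalence.to (isLRMax-suc y w i) max) })
      (λ { (x<w , max) → x<w , Equivalence.from (isLRMax-suc y w i)
                                 (ℕ.≤-<-trans (ℕ.≮⇒≥ x≮y) x<w , max) }))
    (#LRMax>≡lr x w)

#LRMax≡lr : (x : Fin n) (w : Vec (Fin n) k) → # isLRMax? (x ∷ w) ≡ suc (lr x w)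
#LRMax≡lr x w = begin
  # isLRMax? (x ∷ w)
    ≡⟨ #-suc (isLRMax? (x ∷ w)) ⟩
  ⟦ isLRMax? (x ∷ w) zero ⟧ + # (isLRMax? (x ∷ w) ∘ suc)
    ≡⟨ cong₂ _+_
         -- The first letter is always a left-to-right maximum; comparison with a trivially true
         -- proposition turns its bracket into 1.
         (⟦⟧-cong (mk⇔ (λ _ → refl) (λ _ → isLRMax-zero (x ∷ w)))
                  (isLRMax? (x ∷ w) zero) (yes (refl {x = x})))
         (#-cong (isLRMax? (x ∷ w) ∘ suc) (λ i → (x <? lookup w i) ×-dec isLRMax? w i)
                 (isLRMax-suc x w)) ⟩
  suc (# (λ i → (x <? lookup w i) ×-dec isLRMax? w i))
    ≡⟨ cong suc (#LRMax>≡lr x w) ⟩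
  suc (lr x w) ∎
  where open ≡-Reasoning

-- Non-mid-point weak excedances as left-to-right maxima.

transpose-fixes : {i j v : Fin n} → v ≢ i → v ≢ j → transpose i j ⟨$⟩ʳ v ≡ v
transpose-fixes {i = i} {j} {v} v≢i v≢j
  rewrite dec-false (v ≟ i) v≢i | dec-false (v ≟ j) v≢j = refl

transpose-fst : (i j : Fin n) → transpose i j ⟨$⟩ʳ i ≡ j
transpose-fst i j rewrite dec-true (i ≟ i) refl = refl

-- Both directions are pigeonhole arguments: an injection cannot send every element up to a given
-- one strictly below it, which is what `injective⇒existsPivot` expresses.
nonMidWeakExcedance⇔LRMax : (π : Word n) → IsPermutation π → (i : Fin n) →
  (IsWeakExcedance π i × ¬ IsMidPoint π i) ⇔ IsLRMax π i
nonMidWeakExcedance⇔LRMax {n} π (inj , surj) i = mk⇔ to from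
  where
  π⁻¹ : Fin n → Fin n
  π⁻¹ v = proj₁ (surj v)

  π∘π⁻¹ : ∀ v → lookup π (π⁻¹ v) ≡ v
  π∘π⁻¹ v = proj₂ (surj v) refl

  -- If an earlier letter π j exceeded π i ≥ i, then the letters up to π i would
  -- sit, after exchanging the positions i and j, in positions before i: too few.
  to : IsWeakExcedance π i × ¬ IsMidPoint π i → IsLRMax π i
  to (i≤πi , ¬mid) j j<i with lookup π j <? lookup π i
  ... | yes πj<πi = πj<πi
  ... | no  πj≮πi =
    let v , v≤πi , πi≤qv = pivot in
    contradiction πi≤qv (ℕ.<⇒≱ (ℕ.<-≤-trans (q<i v v≤πi) i≤πi))
    where
    πi<πj : lookup π i < lookup π j
    πi<πj = ℕ.≤∧≢⇒< (ℕ.≮⇒≥ πj≮πi) λ e →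
      ℕ.<⇒≢ j<i (cong toℕ (sym (inj (toℕ-injective e))))

    q : Fin n → Fin n
    q v = transpose i j ⟨$⟩ʳ π⁻¹ v

    q-injective : Injective _≡_ _≡_ q
    q-injective {u} {v} qu≡qv = begin
      u                  ≡⟨ π∘π⁻¹ u ⟨
      lookup π (π⁻¹ u)   ≡⟨ cong (lookup π) π⁻¹u≡π⁻¹v ⟩
      lookup π (π⁻¹ v)   ≡⟨ π∘π⁻¹ v ⟩
      v                  ∎
      where
      open ≡-Reasoning
      π⁻¹u≡π⁻¹v : π⁻¹ u ≡ π⁻¹ v
      π⁻¹u≡π⁻¹v = trans (sym (inverseˡ (transpose i j)))
                        (trans (cong (transpose i j ⟨$⟩ˡ_) qu≡qv) (inverseˡ (transpose i j)))

    pivot : ∃ λ v → v ≤ lookup π i × lookup π i ≤ q v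
    pivot = injective⇒existsPivot q-injective (lookup π i)

    -- The position `i` moves to `j < i`. Any other such `p` differs from `j`, whose letter is too
    -- large, so it stays in place; were it beyond `i`, then `j` and `p` would make `i` a mid-point.
    transpose<i : ∀ p → lookup π p ≤ lookup π i → Dec (p ≡ i) → transpose i j ⟨$⟩ʳ p < i
    transpose<i p πp≤πi (yes refl) = subst (_< i) (sym (transpose-fst i j)) j<i
    transpose<i p πp≤πi (no  p≢i)  = subst (_< i) (sym (transpose-fixes p≢i p≢j)) p<i
      where
      p≢j : p ≢ j
      p≢j refl = ℕ.<⇒≱ πi<πj πp≤πi
      p<i : p < i
      p<i = ℕ.≰⇒> λ i≤p → ¬mid
        ( j , p
        , (j<i , ℕ.≤∧≢⇒< i≤p (p≢i ∘ sym ∘ toℕ-injective))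
        , (πi<πj , ℕ.≤∧≢⇒< πp≤πi (p≢i ∘ inj ∘ toℕ-injective)))

    q<i : ∀ v → v ≤ lookup π i → q v < i
    q<i v v≤πi = transpose<i (π⁻¹ v) (subst (_≤ lookup π i) (sym (π∘π⁻¹ v)) v≤πi) (π⁻¹ v ≟ i)

  from : IsLRMax π i → IsWeakExcedance π i × ¬ IsMidPoint π i
  from max = weak , λ { (j , _ , (j<i , _) , (πi<πj , _)) → ℕ.<-asym πi<πj (max j j<i) }
    where
    -- Some position `j ≤ i` carries a letter at least `i`; if `j` is not `i`, that letter is below
    -- `π i` by maximality.
    weak : i ≤ lookup π i
    weak with injective⇒existsPivot inj i
    ... | j , j≤i , i≤πj with j ≟ i
    ...   | yes refl = i≤πj
    ...   | no  j≢i  = ℕ.≤-trans i≤πj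
      (ℕ.<⇒≤ (max j (ℕ.≤∧≢⇒< j≤i (j≢i ∘ toℕ-injective))))

wnm≡#LRMax : (π : Word n) → IsPermutation π → wnm π ≡ # isLRMax? π
wnm≡#LRMax π perm =
  #-cong (λ i → isWeakExcedance? π i ×-dec ¬? (isMidPoint? π i)) (isLRMax? π)
         (nonMidWeakExcedance⇔LRMax π perm)

-- Effect of inserting the letter 2 on the two statistics.

-- In the indexing by Fin, 1F is the letter 2.
raise : Fin (suc n) → Fin (suc (suc n))
raise = punchIn 1F

ins : Vec (Fin (suc n)) k → Fin (suc k) → Vec (Fin (suc (suc n))) (suc k)
ins w i = insertAt (Vec.map raise w) i 1F

raise-< : (x y : Fin (suc n)) → x < y ⇔ raise x < raise y
raise-< zero    zero    = mk⇔ (λ ()) (λ ())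
raise-< zero    (suc y) = mk⇔ (λ _ → s≤s z≤n) (λ _ → s≤s z≤n)
raise-< (suc x) zero    = mk⇔ (λ ()) (λ ())
raise-< (suc x) (suc y) = mk⇔ s≤s s≤s⁻¹

leftOf-raise : (w : Vec (Fin (suc n)) k) → leftOf (Vec.map raise w) ≡ map raise (leftOf w)
leftOf-raise []          = refl
leftOf-raise (zero  ∷ w) = refl
leftOf-raise (suc x ∷ w) = cong (suc (suc x) ∷_) (leftOf-raise w)

All-raise : (x : Fin (suc n)) (w : Vec (Fin (suc n)) k) →
            All (_< raise x) (leftOf (Vec.map raise w)) ⇔ All (_< x) (leftOf w)
All-raise x w rewrite leftOf-raise w = mk⇔
  (All.map (λ {y} → Equivalence.from (raise-< y x)) ∘ All.map⁻)
  (All.map⁺ ∘ All.map (λ {y} → Equivalence.to (raise-< y x)))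

-- If the new letter lands in the prefix before the 1, it satisfies `P` by assumption; otherwise the
-- prefix is the same.
All-insertAt : {P : Pred (Fin (suc (suc n))) 0ℓ} → P 1F →
               (w : Vec (Fin (suc (suc n))) k) (i : Fin (suc k)) →
               All P (leftOf (insertAt w i 1F)) ⇔ All P (leftOf w)
All-insertAt p1 w           zero    = mk⇔ All.tail (p1 ∷_)
All-insertAt p1 (zero  ∷ w) (suc i) = mk⇔ id id
All-insertAt p1 (suc x ∷ w) (suc i) = mk⇔
  (λ { (px ∷ pxs) → px ∷ Equivalence.to   (All-insertAt p1 w i) pxs })
  (λ { (px ∷ pxs) → px ∷ Equivalence.from (All-insertAt p1 w i) pxs })

rl-raise : (w : Vec (Fin (suc n)) k) → rl (Vec.map raise w) ≡ rl w
rl-raise []          = refl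
rl-raise (zero  ∷ w) = refl
rl-raise (suc x ∷ w) =
  cong₂ _+_ (⟦⟧-cong (All-raise (suc x) w) (All.all? _ _) (All.all? _ _)) (rl-raise w)

-- The new letter is smaller than the raised first letter, so inserting it further right does not
-- affect whether the first letter is an RL-maximum.
rl-ins-suc : (x : Fin n) (w : Vec (Fin (suc n)) k) (i : Fin (suc k)) →
             rl (ins (suc x ∷ w) (suc i)) ≡ ⟦ All.all? (_<? suc x) (leftOf w) ⟧ + rl (ins w i)
rl-ins-suc x w i = cong (_+ rl (ins w i))
  (⟦⟧-cong (All-raise (suc x) w ⇔-∘ All-insertAt (s≤s (s≤s z≤n)) (Vec.map raise w) i)
           (All.all? _ _) (All.all? _ _))

tabulate-const : (x : A) → tabulate {n = n} (λ _ → x) ≡ replicate n x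
tabulate-const {n = zero}  x = refl
tabulate-const {n = suc n} x = cong (x ∷_) (tabulate-const x)

-- Left of the 1 but not adjacent to it, the new letter is followed by a larger one; right of the 1
-- it is not seen. Only the place just before the 1 yields a new RL-maximum.
rl-ins : (w : Vec (Fin (suc n)) k) (p : Fin k) → lookup w p ≡ zero →
         tabulate (rl ∘ ins w) ↭ suc (rl w) ∷ replicate k (rl w)
-- The front insertion is left out because `stats-ins` has to treat it on its own: there it creates
-- a left-to-right maximum.
rl-ins-tail : (x : Fin n) (w : Vec (Fin (suc n)) k) (p : Fin k) → lookup w p ≡ zero →
              tabulate (rl ∘ ins (suc x ∷ w) ∘ suc) ↭
              suc (rl (suc x ∷ w)) ∷ replicate k (rl (suc x ∷ w))

rl-ins (zero  ∷ w) _       _    = ↭-reflexive (cong (1 ∷_) (tabulate-const 0))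
rl-ins (suc x ∷ w) (suc p) wp≡0 = begin
  -- At the front the new letter precedes a larger one before the 1, so its bracket computes to 0.
  rl (Vec.map raise (suc x ∷ w)) ∷ tabulate (rl ∘ ins (suc x ∷ w) ∘ suc)
    ≡⟨ cong (_∷ tabulate (rl ∘ ins (suc x ∷ w) ∘ suc)) (rl-raise (suc x ∷ w)) ⟩
  rl (suc x ∷ w) ∷ tabulate (rl ∘ ins (suc x ∷ w) ∘ suc)
    ↭⟨ ↭-prep _ (rl-ins-tail x w p wp≡0) ⟩
  rl (suc x ∷ w) ∷ suc (rl (suc x ∷ w)) ∷ replicate _ (rl (suc x ∷ w))
    ↭⟨ ↭-swap _ _ ↭-refl ⟩
  suc (rl (suc x ∷ w)) ∷ rl (suc x ∷ w) ∷ replicate _ (rl (suc x ∷ w)) ∎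
  where open PermutationReasoning

rl-ins-tail {k = k} x w p wp≡0 = begin
  tabulate (rl ∘ ins (suc x ∷ w) ∘ suc)        ≡⟨ tabulate-cong (rl-ins-suc x w) ⟩
  tabulate (λ i → c + rl (ins w i))            ≡⟨ map-tabulate (rl ∘ ins w) (c +_) ⟨
  map (c +_) (tabulate (rl ∘ ins w))           ↭⟨ map⁺ (c +_) (rl-ins w p wp≡0) ⟩
  c + suc (rl w) ∷ map (c +_) (replicate k (rl w))
    ≡⟨ cong₂ _∷_ (ℕ.+-suc c (rl w)) (map-replicate (c +_) k (rl w)) ⟩
  suc (c + rl w) ∷ replicate k (c + rl w)      ∎
  where
  open PermutationReasoning
  c = ⟦ All.all? (_<? suc x) (leftOf w) ⟧

lr-raise : (x : Fin (suc n)) (w : Vec (Fin (suc n)) k) → lr (raise x) (Vec.map raise w) ≡ lr x w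
lr-raise x []      = refl
lr-raise x (y ∷ w) rewrite sym (does-⇔ (raise-< x y) (x <? y) (raise x <? raise y))
  with does (x <? y)
... | true  = cong suc (lr-raise y w)
... | false = lr-raise x w

-- Without a 1 in `w`, the first letter exceeds either threshold and replaces it.
lr-1-raise : (w : Vec (Fin (suc n)) k) → (∀ i → lookup w i ≢ zero) →
             lr 1F (Vec.map raise w) ≡ lr zero w
lr-1-raise []          _  = refl
lr-1-raise (zero  ∷ w) ≢0 = contradiction refl (≢0 zero)
lr-1-raise (suc x ∷ w) _  = cong suc (lr-raise (suc x) w)

-- The running maximum already exceeds the new letter, which is therefore passed over wherever it is
-- put.
lr-suc-ins : (x : Fin n) (w : Vec (Fin (suc n)) k) (i : Fin (suc k)) →
             lr (suc (suc x)) (ins w i) ≡ lr (suc x) w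
lr-suc-ins x w           zero    = lr-raise (suc x) w
lr-suc-ins x (zero  ∷ w) (suc i) = lr-suc-ins x w i
lr-suc-ins x (suc y ∷ w) (suc i)
  rewrite sym (does-⇔ (raise-< (suc x) (suc y)) (suc x <? suc y) (suc (suc x) <? suc (suc y)))
  with does (suc x <? suc y)
... | true  = cong suc (lr-suc-ins y w i)
... | false = lr-suc-ins x w i

-- On permutations these are `rlm` and `wnm` minus one, by `stats-correct`.
stats : Vec (Fin n) (suc k) → ℕ × ℕ
stats (x ∷ w) = rl (x ∷ w) , lr x w

-- The statistics of all insertions into a word of length k + 1 with statistics (a , b).
extend : ℕ → ℕ × ℕ → List (ℕ × ℕ)
extend k (a , b) = (suc a , b) ∷ (a , suc b) ∷ replicate k (a , b)

-- If the word starts with 1, the places just before and just after it raise the first and the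
-- second statistic respectively. Otherwise the front raises the second, and `rl-ins-tail` accounts
-- for the remaining places.
stats-ins : (w : Vec (Fin (suc n)) (suc k)) (p : Fin (suc k)) →
            lookup w p ≡ zero → Injective _≡_ _≡_ (lookup w) →
            tabulate (stats ∘ ins w) ↭ extend k (stats w)
stats-ins (zero ∷ w) _ _ inj =
  -- Both places next to the leading 1 lead to `lr 1F (Vec.map raise w)`, hence the shared `b`.
  ↭-reflexive (cong₂ (λ b bs → (1 , b) ∷ (0 , suc b) ∷ bs)
    (lr-1-raise w ≢0) (trans (tabulate-cong (rest w ≢0)) (tabulate-const _)))
  where
  ≢0 : ∀ i → lookup w i ≢ zero
  ≢0 i wi≡0 with () ← inj {suc i} {zero} wi≡0

  -- From two places after the 1 onwards, the new letter comes after a larger one.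
  rest : (v : Vec (Fin (suc _)) l) → (∀ i → lookup v i ≢ zero) →
         ∀ i → stats (ins (zero ∷ v) (suc (suc i))) ≡ (0 , lr zero v)
  rest (zero  ∷ v) ≢0 i = contradiction refl (≢0 zero)
  rest (suc y ∷ v) _  i = cong (λ b → 0 , suc b) (lr-suc-ins y v i)
stats-ins {k = k} (suc x ∷ w) (suc p) wp≡0 _ = begin
  (rl (Vec.map raise (suc x ∷ w)) , suc (lr (suc (suc x)) (Vec.map raise w))) ∷
    tabulate (stats ∘ ins (suc x ∷ w) ∘ suc)
    ≡⟨ cong₂ _∷_ (cong₂ (λ a b → a , suc b) (rl-raise (suc x ∷ w)) (lr-raise (suc x) w))
                 (tabulate-cong λ i → cong (rl (ins (suc x ∷ w) (suc i)) ,_) (lr-suc-ins x w i)) ⟩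
  (a , suc b) ∷ tabulate (λ i → rl (ins (suc x ∷ w) (suc i)) , b)
    ≡⟨ cong ((a , suc b) ∷_) (map-tabulate (rl ∘ ins (suc x ∷ w) ∘ suc) (_, b)) ⟨
  (a , suc b) ∷ map (_, b) (tabulate (rl ∘ ins (suc x ∷ w) ∘ suc))
    ↭⟨ ↭-prep _ (map⁺ (_, b) (rl-ins-tail x w p wp≡0)) ⟩
  (a , suc b) ∷ (suc a , b) ∷ map (_, b) (replicate k a)
    ≡⟨ cong (λ ps → (a , suc b) ∷ (suc a , b) ∷ ps) (map-replicate (_, b) k a) ⟩
  (a , suc b) ∷ (suc a , b) ∷ replicate k (a , b)
    ↭⟨ ↭-swap _ _ ↭-refl ⟩
  (suc a , b) ∷ (a , suc b) ∷ replicate k (a , b) ∎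
  where
  open PermutationReasoning
  a = rl (suc x ∷ w)
  b = lr (suc x) w

-- Insertion as a bijection onto the longer permutations.

data PunchView (i : Fin (suc n)) : Fin (suc n) → Set where
  hole : PunchView i i
  in-  : (j : Fin n) → PunchView i (punchIn i j)

-- This separates the new position of `ins w i` from the old ones and, at `1F`, the new letter from
-- the raised ones.
punchView : (i j : Fin (suc n)) → PunchView i j
punchView i j with i ≟ j
... | yes refl = hole
... | no  i≢j  = subst (PunchView i) (punchIn-punchOut i≢j) (in- (punchOut i≢j))

vec-ext : {v w : Vec A n} → lookup v ≗ lookup w → v ≡ w
vec-ext {v = v} {w} eq =
  trans (sym (tabulate∘lookup v)) (trans (Vec.tabulate-cong eq) (tabulate∘lookup w))

lookup-ins : (w : Vec (Fin (suc n)) k) (i : Fin (suc k)) → lookup (ins w i) i ≡ 1F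
lookup-ins w i = insertAt-lookup (Vec.map raise w) i 1F

lookup-ins-punchIn : (w : Vec (Fin (suc n)) k) (i : Fin (suc k)) (j : Fin k) →
                     lookup (ins w i) (punchIn i j) ≡ raise (lookup w j)
lookup-ins-punchIn w i j =
  trans (insertAt-punchIn (Vec.map raise w) i 1F j) (lookup-map j raise w)

-- Raised letters are never `1F`, so the place of `1F` determines the index, and the other places
-- then determine the word.
ins-injective : {v w : Vec (Fin (suc n)) k} {i j : Fin (suc k)} →
                ins v i ≡ ins w j → v ≡ w × i ≡ j
ins-injective {v = v} {w} {i} {j} eq with punchView j i
... | in- j′ = contradiction
  (trans (sym (lookup-ins-punchIn w j j′))
         (trans (cong (λ u → lookup u (punchIn j j′)) (sym eq)) (lookup-ins v (punchIn j j′))))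
  (punchInᵢ≢i 1F (lookup w j′))
... | hole = vec-ext (λ l → punchIn-injective 1F _ _
  (trans (sym (lookup-ins-punchIn v i l))
         (trans (cong (λ u → lookup u (punchIn i l)) eq) (lookup-ins-punchIn w i l)))) , refl

ins-isPermutation : (w : Word (suc n)) (i : Fin (suc (suc n))) →
                    IsPermutation w → IsPermutation (ins w i)
ins-isPermutation w i (inj , surj) = injective , surjective
  where
  injective : Injective _≡_ _≡_ (lookup (ins w i))
  injective {a} {b} eq with punchView i a | punchView i b
  ... | hole   | hole   = refl
  ... | hole   | in- b′ = contradiction
    (trans (sym (lookup-ins-punchIn w i b′)) (trans (sym eq) (lookup-ins w i)))
    (punchInᵢ≢i 1F (lookup w b′))
  ... | in- a′ | hole   = contradiction
    (trans (sym (lookup-ins-punchIn w i a′)) (trans eq (lookup-ins w i)))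
    (punchInᵢ≢i 1F (lookup w a′))
  ... | in- a′ | in- b′ = cong (punchIn i) (inj (punchIn-injective 1F _ _
    (trans (sym (lookup-ins-punchIn w i a′)) (trans eq (lookup-ins-punchIn w i b′)))))

  surjective : Surjective _≡_ _≡_ (lookup (ins w i))
  surjective v with punchView 1F v
  ... | hole  = i , λ { refl → lookup-ins w i }
  ... | in- u = punchIn i (proj₁ (surj u)) , λ { refl →
    trans (lookup-ins-punchIn w i (proj₁ (surj u))) (cong raise (proj₂ (surj u) refl)) }

ins⁻-isPermutation : (w : Word (suc n)) (i : Fin (suc (suc n))) →
                     IsPermutation (ins w i) → IsPermutation w
ins⁻-isPermutation w i (inj , surj) = injective , surjective
  where
  injective : Injective _≡_ _≡_ (lookup w)
  injective {a} {b} eq = punchIn-injective i a b (inj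
    (trans (lookup-ins-punchIn w i a) (trans (cong raise eq) (sym (lookup-ins-punchIn w i b)))))

  surjective : Surjective _≡_ _≡_ (lookup w)
  surjective v with surj (raise v)
  ... | p , eq with punchView i p
  ...   | hole   = contradiction (trans (sym (eq refl)) (lookup-ins w i)) (punchInᵢ≢i 1F v)
  ...   | in- p′ = p′ , λ { refl → punchIn-injective 1F _ _
    (trans (sym (lookup-ins-punchIn w i p′)) (eq refl)) }

-- Deleting `1F` and lowering the larger letters by `punchOut` undoes an insertion; injectivity of
-- `σ` ensures that no other place holds `1F`.
ins-surjective : (σ : Word (suc (suc n))) → IsPermutation σ → ∃₂ λ w i → σ ≡ ins w i
ins-surjective {n} σ (inj , surj) = w , i , vec-ext same
  where
  i = proj₁ (surj 1F)

  σi≡1 : lookup σ i ≡ 1F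
  σi≡1 = proj₂ (surj 1F) refl

  1≢ : ∀ j → 1F ≢ lookup σ (punchIn i j)
  1≢ j 1≡ = punchInᵢ≢i i j (inj (trans (sym 1≡) (sym σi≡1)))

  w : Word (suc n)
  w = Vec.tabulate λ j → punchOut (1≢ j)

  same : lookup σ ≗ lookup (ins w i)
  same p with punchView i p
  ... | hole  = trans σi≡1 (sym (lookup-ins w i))
  ... | in- j = sym (trans (lookup-ins-punchIn w i j)
    (trans (cong raise (lookup∘tabulate (λ j → punchOut (1≢ j)) j)) (punchIn-punchOut (1≢ j))))

-- Two duplicate-free lists with the same members are rearrangements of each other.
𝕊-suc : ∀ n → 𝕊 (suc (suc n)) ↭ cartesianProductWith ins (𝕊 (suc n)) (allFin (suc (suc n)))
𝕊-suc n = ∼bag⇒↭ (unique∧set⇒bag (𝕊-unique (suc (suc n)))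
  (cartesianProductWith⁺ ins ins-injective (𝕊-unique (suc n)) (allFin⁺ (suc (suc n))))
  (mk⇔ to from))
  where
  to : ∀ {σ} → σ ∈ 𝕊 (suc (suc n)) → σ ∈ cartesianProductWith ins (𝕊 (suc n)) (allFin _)
  to {σ} σ∈ with perm ← Equivalence.to (∈-𝕊 σ) σ∈ with ins-surjective σ perm
  ... | w , i , refl = ∈-cartesianProductWith⁺ ins
    (Equivalence.from (∈-𝕊 w) (ins⁻-isPermutation w i perm)) (∈-allFin i)

  from : ∀ {σ} → σ ∈ cartesianProductWith ins (𝕊 (suc n)) (allFin _) → σ ∈ 𝕊 (suc (suc n))
  from σ∈ with ∈-cartesianProductWith⁻ ins (𝕊 (suc n)) (allFin _) σ∈
  ... | w , i , w∈ , _ , refl = Equivalence.from (∈-𝕊 (ins w i))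
    (ins-isPermutation w i (Equivalence.to (∈-𝕊 w) w∈))

-- Symmetry of the joint distribution.

𝕊-permutations : ∀ n → All IsPermutation (𝕊 n)
𝕊-permutations n = All.tabulate λ {π} → Equivalence.to (∈-𝕊 π)

map-stats-ins : {ws : List (Word (suc n))} → All IsPermutation ws →
                map stats (cartesianProductWith ins ws (allFin _)) ↭
                concatMap (extend n) (map stats ws)
map-stats-ins []                              = ↭-refl
map-stats-ins {n} {w ∷ ws} ((inj , surj) ∷ perms) = begin
  map stats (map (ins w) (allFin _) ++ cartesianProductWith ins ws (allFin _))
    ≡⟨ map-++ stats (map (ins w) (allFin _)) _ ⟩
  map stats (map (ins w) (allFin _)) ++ map stats (cartesianProductWith ins ws (allFin _))
    ≡⟨ cong (_++ map stats (cartesianProductWith ins ws (allFin _)))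
            (trans (sym (map-∘ (allFin _))) (map-tabulate id (stats ∘ ins w))) ⟩
  tabulate (stats ∘ ins w) ++ map stats (cartesianProductWith ins ws (allFin _))
    ↭⟨ ++⁺ (stats-ins w (proj₁ (surj zero)) (proj₂ (surj zero) refl) inj) (map-stats-ins perms) ⟩
  extend n (stats w) ++ concatMap (extend n) (map stats ws) ∎
  where open PermutationReasoning

concatMap-↭ : {f g : A → List B} → (∀ x → f x ↭ g x) →
              {xs ys : List A} → xs ↭ ys → concatMap f xs ↭ concatMap g ys
concatMap-↭ {f = f} {g} f↭g {xs} xs↭ys = ↭-trans (pointwise xs) (permute xs↭ys)
  where
  pointwise : ∀ xs → concatMap f xs ↭ concatMap g xs
  pointwise []       = ↭-refl
  pointwise (x ∷ xs) = ++⁺ (f↭g x) (pointwise xs)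

  permute : ∀ {xs ys} → xs ↭ ys → concatMap g xs ↭ concatMap g ys
  permute _↭_.refl         = ↭-refl
  permute (_↭_.prep x p)   = ++⁺ˡ (g x) (permute p)
  permute (_↭_.swap x y p) = ↭-trans (shifts (g x) (g y)) (++⁺ˡ (g y) (++⁺ˡ (g x) (permute p)))
  permute (_↭_.trans p q)  = ↭-trans (permute p) (permute q)

-- This is the symmetry of the factor x + y + k: swapping coordinates exchanges the roles of the
-- first two pairs.
extend-swap : ∀ k ab → map swap (extend k ab) ↭ extend k (swap ab)
extend-swap k (a , b) =
  ↭-swap _ _ (↭-reflexive (map-replicate swap k (a , b)))

stats-symmetric : ∀ n → map stats (𝕊 (suc n)) ↭ map swap (map stats (𝕊 (suc n)))
-- The only permutation of one letter has statistics `(0 , 0)`.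
stats-symmetric zero    = ↭-refl
stats-symmetric (suc n) = begin
  map stats (𝕊 (suc (suc n)))                          ↭⟨ recursion ⟩
  concatMap (extend n) X                               ↭⟨ concatMap-↭ (λ _ → ↭-refl) (stats-symmetric n) ⟩
  concatMap (extend n) (map swap X)                    ≡⟨ concatMap-map (extend n) swap X ⟩
  concatMap (extend n ∘′ swap) X                       ↭⟨ concatMap-↭ (extend-swap n) (↭-refl {x = X}) ⟨
  concatMap (map swap ∘′ extend n) X                   ≡⟨ map-concatMap swap (extend n) X ⟨
  map swap (concatMap (extend n) X)                    ↭⟨ map⁺ swap recursion ⟨
  map swap (map stats (𝕊 (suc (suc n))))               ∎
  where
  open PermutationReasoning
  X = map stats (𝕊 (suc n))
  recursion : map stats (𝕊 (suc (suc n))) ↭ concatMap (extend n) X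
  recursion = ↭-trans (map⁺ stats (𝕊-suc n)) (map-stats-ins (𝕊-permutations (suc n)))

-- Return to the original statistics.

stats-correct : (π : Word (suc n)) → IsPermutation π →
                _≡_ {A = ℤ × ℤ} (rlmℤ π , wnm-1 π) (Product.map ℤ.+_ ℤ.+_ (stats π))
stats-correct π@(x ∷ w) perm = cong₂ _,_
  (cong ℤ.+_ (#RLMax≡rl π))
  -- Subtracting 1 cancels the successor from `#LRMax≡lr` by computation.
  (cong (λ m → ℤ.+ m ℤ.- ℤ.+ 1) (trans (wnm≡#LRMax π perm) (#LRMax≡lr x w)))

theorem1p4 : (n : ℕ) → n ≥ 1 → EquallyDistributed (𝕊 n) (rlmℤ , wnm-1) (wnm-1 , rlmℤ)
theorem1p4 (suc n) _ a₁ a₂ = begin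
  length (filter (λ π → (rlmℤ π ℤ.≟ a₁) ×-dec (wnm-1 π ℤ.≟ a₂)) (𝕊 (suc n)))
    ≡⟨ length-filter-map _ Q? stats (All.map (λ {π} → ≡⇒ ∘ cong P ∘ stats-correct π) perms) ⟩
  length (filter Q? (map stats (𝕊 (suc n))))
    ≡⟨ ↭-length (filter-↭ Q? (stats-symmetric n)) ⟩
  length (filter Q? (map swap (map stats (𝕊 (suc n)))))
    ≡⟨ cong (length ∘ filter Q?) (map-∘ (𝕊 (suc n))) ⟨
  length (filter Q? (map (swap ∘ stats) (𝕊 (suc n))))
    ≡⟨ length-filter-map _ Q? (swap ∘ stats)
         (All.map (λ {π} → ≡⇒ ∘ cong (P ∘ swap) ∘ stats-correct π) perms) ⟨
  length (filter (λ π → (wnm-1 π ℤ.≟ a₁) ×-dec (rlmℤ π ℤ.≟ a₂)) (𝕊 (suc n))) ∎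
  where
  open ≡-Reasoning

  perms = 𝕊-permutations (suc n)

  -- A predicate on pairs lets one equation from `stats-correct` replace both statistics at once, in
  -- either order.
  P : ℤ × ℤ → Set
  P (x , y) = x ≡ a₁ × y ≡ a₂

  Q? : Decidable (λ ((a , b) : ℕ × ℕ) → P (ℤ.+ a , ℤ.+ b))
  Q? (a , b) = (ℤ.+ a ℤ.≟ a₁) ×-dec (ℤ.+ b ℤ.≟ a₂)
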